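{- Let $n\geq 4$, let $S$ be the set of all $3$-cycles in $S_n$, and let $CAG_n=\mathrm{Cay}(A_n,S)$. Then the map $h:\alpha\mapsto\alpha^{ -1}$ ($\alpha\in A_n$) is an automorphism of the graph $CAG_n$. In particular, $CAG_n$ is not a normal Cayley graph, i.e. $R(A_n)$ is not a normal subgroup of $\mathrm{Aut}(CAG_n)$.
   Context: For a finite group $\Gamma$ and a subset $T\subseteq\Gamma$ with $e\notin T$ and $T=T^{ -1}$, the Cayley graph $\mathrm{Cay}(\Gamma,T)$ is the undirected graph with vertex set $\Gamma$ and edge set $\{\{\gamma,t\gamma\}\mid \gamma\in\Gamma, t\in T\}$. The right regular representation $R(\Gamma)=\{r_\gamma: x\mapsto x\gamma\mid\gamma\in\Gamma\}$ is a subgroup of $\mathrm{Aut}(\mathrm{Cay}(\Gamma,T))$; the Cayley graph is called normal if $R(\Gamma)$ is a normal subgroup of $\mathrm{Aut}(\mathrm{Cay}(\Gamma,T))$. -}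

module Defs where

open import Level using (Level; _⊔_; suc; 0ℓ)
open import Algebra.Bundles using (Group)
import Algebra.Properties.Group as GroupProperties
open import Data.Empty using (⊥-elim)
open import Data.Fin.Base using (Fin)
open import Data.Fin.Permutation as Perm
  using (Permutation′; _⟨$⟩ʳ_; _⟨$⟩ˡ_; _∘ₚ_)
open import Data.Fin.Permutation.Transposition.List using (TranspositionList; eval)
import Data.Fin.Properties as Fin
open import Data.List.Base using ([]; _∷_; _++_; length)
open import Data.List.Properties using (length-++)
open import Data.List.Relation.Unary.All using (All; []; _∷_)
open import Data.List.Relation.Unary.All.Properties using (++⁺)
open import Data.Nat.Base using (ℕ; _+_)
open import Data.Nat.Divisibility using (_∣_; divides-refl; ∣m∣n⇒∣m+n)
open import Data.Nat.Properties using (+-comm)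
open import Data.Product.Base using (Σ; ∃; ∃₂; _×_; _,_; proj₁; proj₂)
open import Data.Sum.Base using (_⊎_; inj₁; inj₂)
open import Function.Base using (_∘_; _on_)
open import Function.Bundles using (_⇔_; mk⇔; Equivalence)
import Function.Construct.Composition as Composition
import Function.Construct.Identity as Identity
import Function.Construct.Symmetry as Symmetry
open import Function.Structures using (IsBijection)
open import Relation.Binary.Bundles using (Setoid)
open import Relation.Binary.Core using (Rel)
open import Relation.Binary.Definitions using (Symmetric)
open import Relation.Binary.PropositionalEquality
  using (_≡_; _≢_; refl; sym; trans; cong; subst; ≢-sym)
open import Relation.Nullary using (¬_; yes; no)
open import Relation.Unary using (Pred; _∈_; _∉_)

private
  variable
    c ℓ e p : Level

record Subgroup (G : Group c ℓ) (p : Level) : Set (c ⊔ ℓ ⊔ suc p) where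
  open Group G
  field
    Member    : Pred Carrier p
    resp      : ∀ {x y} → x ≈ y → x ∈ Member → y ∈ Member
    ε-closed  : ε ∈ Member
    ∙-closed  : ∀ {x y} → x ∈ Member → y ∈ Member → x ∙ y ∈ Member
    ⁻¹-closed : ∀ {x} → x ∈ Member → x ⁻¹ ∈ Member

  -- Membership proofs are ignored by the equality.
  group : Group (c ⊔ p) ℓ
  group = record
    { Carrier = Σ Carrier Member
    ; _≈_     = _≈_ on proj₁
    ; _∙_     = λ (x , x∈) (y , y∈) → x ∙ y , ∙-closed x∈ y∈
    ; ε       = ε , ε-closed
    ; _⁻¹     = λ (x , x∈) → x ⁻¹ , ⁻¹-closed x∈
    ; isGroup = record
      { isMonoid = record
        { isSemigroup = record
          { isMagma = record
            { isEquivalence = record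
              { refl  = Group.refl G
              ; sym   = Group.sym G
              ; trans = Group.trans G
              }
            ; ∙-cong = ∙-cong
            }
          ; assoc = λ (x , _) (y , _) (z , _) → assoc x y z
          }
        ; identity = (λ (x , _) → identityˡ x) , (λ (x , _) → identityʳ x)
        }
      ; inverse = (λ (x , _) → inverseˡ x) , (λ (x , _) → inverseʳ x)
      ; ⁻¹-cong = ⁻¹-cong
      }
    }

IsNormal : {G : Group c ℓ} → Subgroup G p → Set (c ⊔ p)
IsNormal {G = G} H = ∀ g {h} → h ∈ Member → g ∙ h ∙ g ⁻¹ ∈ Member
  where
  open Group G
  open Subgroup H

record Graph c ℓ e : Set (suc (c ⊔ ℓ ⊔ e)) where
  field
    vertices : Setoid c ℓ
  open Setoid vertices public using (_≈_) renaming (Carrier to Vertex)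
  field
    _~_      : Rel Vertex e
    ~-resp   : ∀ {x x′ y y′} → x ≈ x′ → y ≈ y′ → x ~ y → x′ ~ y′
    ~-sym    : Symmetric _~_
    ~-irrefl : ∀ {x} → ¬ (x ~ x)

module _ (𝒢 : Graph c ℓ e) where
  open Graph 𝒢
  private module V = Setoid vertices

  record IsAutomorphism (f : Vertex → Vertex) : Set (c ⊔ ℓ ⊔ e) where
    field
      isBijection : IsBijection _≈_ _≈_ f
      adjacency   : ∀ x y → (x ~ y) ⇔ (f x ~ f y)
    open IsBijection isBijection public

  record Automorphism : Set (c ⊔ ℓ ⊔ e) where
    field
      to             : Vertex → Vertex
      isAutomorphism : IsAutomorphism to
    open IsAutomorphism isAutomorphism public

  private
    open Automorphism

    idₐ : Automorphism
    idₐ = record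
      { to             = λ x → x
      ; isAutomorphism = record
        { isBijection = Identity.isBijection V.isEquivalence
        ; adjacency   = λ _ _ → mk⇔ (λ a → a) (λ a → a)
        }
      }

    _∘ₐ_ : Automorphism → Automorphism → Automorphism
    f ∘ₐ g = record
      { to             = to f ∘ to g
      ; isAutomorphism = record
        { isBijection = Composition.isBijection (isBijection g) (isBijection f)
        ; adjacency   = λ x y → mk⇔
            (Equivalence.to (adjacency f _ _) ∘ Equivalence.to (adjacency g x y))
            (Equivalence.from (adjacency g x y) ∘ Equivalence.from (adjacency f _ _))
        }
      }

    from : Automorphism → Vertex → Vertex
    from f y = proj₁ (strictlySurjective f y)

    to∘from : ∀ f y → to f (from f y) ≈ y
    to∘from f y = proj₂ (strictlySurjective f y)

    from∘to : ∀ f x → from f (to f x) ≈ x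
    from∘to f x = injective f (to∘from f (to f x))

    from-cong : ∀ f {x y} → x ≈ y → from f x ≈ from f y
    from-cong f {x} {y} x≈y =
      injective f (V.trans (to∘from f x) (V.trans x≈y (V.sym (to∘from f y))))

    _⁻¹ₐ : Automorphism → Automorphism
    f ⁻¹ₐ = record
      { to             = from f
      ; isAutomorphism = record
        { isBijection = Symmetry.isBijection (isBijection f) (from-cong f)
        ; adjacency   = λ x y → mk⇔
            (λ x~y → Equivalence.from (adjacency f _ _)
                       (~-resp (V.sym (to∘from f x)) (V.sym (to∘from f y)) x~y))
            (λ a → ~-resp (to∘from f x) (to∘from f y) (Equivalence.to (adjacency f _ _) a))
        }
      }

  Aut : Group (c ⊔ ℓ ⊔ e) (c ⊔ ℓ)
  Aut = record
    { Carrier = Automorphism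
    ; _≈_     = λ f g → ∀ x → to f x ≈ to g x
    ; _∙_     = _∘ₐ_
    ; ε       = idₐ
    ; _⁻¹     = _⁻¹ₐ
    ; isGroup = record
      { isMonoid = record
        { isSemigroup = record
          { isMagma = record
            { isEquivalence = record
              { refl  = λ _ → V.refl
              ; sym   = λ f≈g x → V.sym (f≈g x)
              ; trans = λ f≈g g≈h x → V.trans (f≈g x) (g≈h x)
              }
            ; ∙-cong = λ {f} {f′} {g} {g′} f≈f′ g≈g′ x →
                V.trans (Automorphism.cong f (g≈g′ x)) (f≈f′ (to g′ x))
            }
          ; assoc = λ _ _ _ _ → V.refl
          }
        ; identity = (λ _ _ → V.refl) , (λ _ _ → V.refl)
        }
      ; inverse = (λ f → from∘to f) , (λ f → to∘from f)
      ; ⁻¹-cong = λ {f} {g} f≈g x → injective f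
          (V.trans (to∘from f x) (V.sym (V.trans (f≈g (from g x)) (to∘from g x))))
      }
    }

record ConnectionSet (Γ : Group c ℓ) (p : Level) : Set (c ⊔ ℓ ⊔ suc p) where
  open Group Γ
  field
    Member    : Pred Carrier p
    resp      : ∀ {x y} → x ≈ y → x ∈ Member → y ∈ Member
    ε∉        : ε ∉ Member
    -- T⁻¹ ⊆ T is equivalent to T = T⁻¹, since inversion is an involution.
    ⁻¹-closed : ∀ {x} → x ∈ Member → x ⁻¹ ∈ Member

module _ (Γ : Group c ℓ) (T : ConnectionSet Γ p) where
  open Group Γ hiding (refl; sym; trans)
  open ConnectionSet T
  private module Γ = Group Γ
  open GroupProperties Γ

  -- {x , y} = {γ , t γ} as unordered pairs, for some γ ∈ Γ and t ∈ T.
  CayleyAdjacent : Rel Carrier (c ⊔ ℓ ⊔ p)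
  CayleyAdjacent x y = ∃₂ λ γ t →
    t ∈ Member × ((x ≈ γ × y ≈ t ∙ γ) ⊎ (x ≈ t ∙ γ × y ≈ γ))

  private
    γ≉tγ : ∀ {γ t} → t ∈ Member → ¬ (γ ≈ t ∙ γ)
    γ≉tγ {γ} {t} t∈ γ≈tγ = ε∉ (resp (identityˡ-unique t γ (Γ.sym γ≈tγ)) t∈)

  Cay : Graph c ℓ (c ⊔ ℓ ⊔ p)
  Cay = record
    { vertices = setoid
    ; _~_      = CayleyAdjacent
    ; ~-resp   = λ x≈x′ y≈y′ → λ where
        (γ , t , t∈ , inj₁ (x≈ , y≈)) → γ , t , t∈ ,
          inj₁ (Γ.trans (Γ.sym x≈x′) x≈ , Γ.trans (Γ.sym y≈y′) y≈)
        (γ , t , t∈ , inj₂ (x≈ , y≈)) → γ , t , t∈ ,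
          inj₂ (Γ.trans (Γ.sym x≈x′) x≈ , Γ.trans (Γ.sym y≈y′) y≈)
    ; ~-sym    = λ where
        (γ , t , t∈ , inj₁ (x≈ , y≈)) → γ , t , t∈ , inj₂ (y≈ , x≈)
        (γ , t , t∈ , inj₂ (x≈ , y≈)) → γ , t , t∈ , inj₁ (y≈ , x≈)
    ; ~-irrefl = λ where
        (γ , t , t∈ , inj₁ (x≈ , y≈)) → γ≉tγ t∈ (Γ.trans (Γ.sym x≈) y≈)
        (γ , t , t∈ , inj₂ (x≈ , y≈)) → γ≉tγ t∈ (Γ.trans (Γ.sym y≈) x≈)
    }

  private
    translate : ∀ γ {x y} → CayleyAdjacent x y → CayleyAdjacent (x ∙ γ) (y ∙ γ)
    translate γ (δ , t , t∈ , inj₁ (x≈ , y≈)) = δ ∙ γ , t , t∈ ,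
      inj₁ (∙-congʳ x≈ , Γ.trans (∙-congʳ y≈) (assoc t δ γ))
    translate γ (δ , t , t∈ , inj₂ (x≈ , y≈)) = δ ∙ γ , t , t∈ ,
      inj₂ (Γ.trans (∙-congʳ x≈) (assoc t δ γ) , ∙-congʳ y≈)

  rightMultiplication : Carrier → Automorphism Cay
  rightMultiplication γ = record
    { to             = _∙ γ
    ; isAutomorphism = record
      { isBijection = record
        { isInjection = record
          { isCongruent = record
            { cong           = ∙-congʳ
            ; isEquivalence₁ = isEquivalence
            ; isEquivalence₂ = isEquivalence
            }
          ; injective = ∙-cancelʳ γ _ _
          }
        ; surjective = λ y → y ∙ γ ⁻¹ ,
            λ z≈ → Γ.trans (∙-congʳ z≈) (//-rightDividesˡ γ y)
        }
      ; adjacency = λ x y → mk⇔ (translate γ)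
          (λ a → Graph.~-resp Cay (//-rightDividesʳ γ x) (//-rightDividesʳ γ y)
                   (translate (γ ⁻¹) a))
      }
    }

  RightRegular : Subgroup (Aut Cay) (c ⊔ ℓ)
  RightRegular = record
    { Member    = λ φ → ∃ λ γ → φ A.≈ rightMultiplication γ
    ; resp      = λ φ≈ψ (γ , φ≈r) → γ , λ x → Γ.trans (Γ.sym (φ≈ψ x)) (φ≈r x)
    ; ε-closed  = ε , λ x → Γ.sym (identityʳ x)
    ; ∙-closed  = λ {φ} {ψ} (γ , φ≈r) (δ , ψ≈r) → δ ∙ γ , λ x →
        Γ.trans (φ≈r _) (Γ.trans (∙-congʳ (ψ≈r x)) (assoc x δ γ))
    ; ⁻¹-closed = λ {φ} (γ , φ≈r) → γ ⁻¹ , λ x →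
        Γ.trans (Γ.sym (//-rightDividesʳ γ _))
          (∙-congʳ (Γ.trans (Γ.sym (φ≈r _)) (A.inverseʳ φ x)))
    }
    where module A = Group (Aut Cay)

  IsNormalCayley : Set (c ⊔ ℓ ⊔ p)
  IsNormalCayley = IsNormal RightRegular

private
  variable
    n : ℕ

  ˡ-cong : (π ρ : Permutation′ n) → π Perm.≈ ρ → ∀ i → π ⟨$⟩ˡ i ≡ ρ ⟨$⟩ˡ i
  ˡ-cong π ρ π≈ρ i = trans
    (cong (π ⟨$⟩ˡ_) (sym (trans (π≈ρ _) (Perm.inverseʳ ρ))))
    (Perm.inverseˡ π)

-- Products are read from left to right: (π ∙ ρ) i = ρ (π i).
Sym : ℕ → Group 0ℓ 0ℓ
Sym n = record
  { Carrier = Permutation′ n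
  ; _≈_     = Perm._≈_
  ; _∙_     = _∘ₚ_
  ; ε       = Perm.id
  ; _⁻¹     = Perm.flip
  ; isGroup = record
    { isMonoid = record
      { isSemigroup = record
        { isMagma = record
          { isEquivalence = record
            { refl  = λ _ → refl
            ; sym   = λ π≈ρ i → sym (π≈ρ i)
            ; trans = λ π≈ρ ρ≈σ i → trans (π≈ρ i) (ρ≈σ i)
            }
          ; ∙-cong = λ {π} {π′} {ρ} {ρ′} π≈π′ ρ≈ρ′ i →
              trans (cong (ρ ⟨$⟩ʳ_) (π≈π′ i)) (ρ≈ρ′ (π′ ⟨$⟩ʳ i))
          }
        ; assoc = λ _ _ _ _ → refl
        }
      ; identity = (λ _ _ → refl) , (λ _ _ → refl)
      }
    ; inverse = (λ π _ → Perm.inverseʳ π) , (λ π _ → Perm.inverseˡ π)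
    ; ⁻¹-cong = λ {π} {ρ} → ˡ-cong π ρ
    }
  }

-- A product of an even number of transpositions.  The library's
-- `TranspositionList` admits the degenerate entries (i , i), which evaluate to
-- the identity; they have to be excluded for the length to determine a parity.
Proper : TranspositionList n → Set
Proper = All (λ (i , j) → i ≢ j)

IsEven : Pred (Permutation′ n) 0ℓ
IsEven {n} π = ∃ λ (ts : TranspositionList n) →
  Proper ts × 2 ∣ length ts × eval ts Perm.≈ π

private
  eval-++ : (ss ts : TranspositionList n) →
            eval (ss ++ ts) Perm.≈ (eval ss ∘ₚ eval ts)
  eval-++ []             ts i = refl
  eval-++ ((_ , _) ∷ ss) ts i = eval-++ ss ts _

  eval⁻¹ : (ts : TranspositionList n) → Proper ts →
           ∃ λ ss → Proper ss × length ss ≡ length ts × eval ss Perm.≈ Perm.flip (eval ts)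
  eval⁻¹ []             []         = [] , [] , refl , λ _ → refl
  eval⁻¹ ((i , j) ∷ ts) (i≢j ∷ ps) with eval⁻¹ ts ps
  ... | ss , qs , ∣ss∣≡ , ss≈ =
    ss ++ (j , i) ∷ [] , ++⁺ qs (≢-sym i≢j ∷ []) ,
    trans (length-++ ss) (trans (+-comm _ 1) (cong (1 +_) ∣ss∣≡)) ,
    λ k → trans (eval-++ ss _ k) (cong (Perm.transpose j i ⟨$⟩ʳ_) (ss≈ k))

AlternatingSubgroup : ∀ n → Subgroup (Sym n) 0ℓ
AlternatingSubgroup n = record
  { Member    = IsEven
  ; resp      = λ π≈ρ (ts , ps , 2∣ , ts≈) → ts , ps , 2∣ , λ i → trans (ts≈ i) (π≈ρ i)
  ; ε-closed  = [] , [] , divides-refl 0 , λ _ → refl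
  ; ∙-closed  = λ {π} {ρ} (ss , ps , 2∣ss , ss≈) (ts , qs , 2∣ts , ts≈) →
      ss ++ ts , ++⁺ ps qs ,
      subst (2 ∣_) (sym (length-++ ss)) (∣m∣n⇒∣m+n 2∣ss 2∣ts) ,
      λ i → trans (eval-++ ss ts i) (trans (ts≈ _) (cong (ρ ⟨$⟩ʳ_) (ss≈ i)))
  ; ⁻¹-closed = λ {π} (ts , ps , 2∣ , ts≈) →
      let ss , qs , ∣ss∣≡ , ss≈ = eval⁻¹ ts ps in
      ss , qs , subst (2 ∣_) (sym ∣ss∣≡) 2∣ ,
      λ i → trans (ss≈ i) (ˡ-cong (eval ts) π ts≈ i)
  }

Alt : ℕ → Group 0ℓ 0ℓ
Alt n = Subgroup.group (AlternatingSubgroup n)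

-- π is the cycle i ↦ j ↦ k ↦ i.
record IsThreeCycle (π : Permutation′ n) : Set where
  field
    i j k : Fin n
    i≢j   : i ≢ j
    j≢k   : j ≢ k
    k≢i   : k ≢ i
    i↦j   : π ⟨$⟩ʳ i ≡ j
    j↦k   : π ⟨$⟩ʳ j ≡ k
    k↦i   : π ⟨$⟩ʳ k ≡ i
    fixes : ∀ l → l ≢ i → l ≢ j → l ≢ k → π ⟨$⟩ʳ l ≡ l

private
  transpose-first : (i j : Fin n) → Perm.transpose i j ⟨$⟩ʳ i ≡ j
  transpose-first i j with i Fin.≟ i
  ... | yes _  = refl
  ... | no i≢i = ⊥-elim (i≢i refl)

  transpose-second : (i j : Fin n) → Perm.transpose i j ⟨$⟩ʳ j ≡ i
  transpose-second i j with j Fin.≟ i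
  ... | yes j≡i = j≡i
  ... | no _ with j Fin.≟ j
  ...   | yes _  = refl
  ...   | no j≢j = ⊥-elim (j≢j refl)

  transpose-other : (i j : Fin n) {l : Fin n} → l ≢ i → l ≢ j →
                    Perm.transpose i j ⟨$⟩ʳ l ≡ l
  transpose-other i j {l} l≢i l≢j with l Fin.≟ i
  ... | yes l≡i = ⊥-elim (l≢i l≡i)
  ... | no _ with l Fin.≟ j
  ...   | yes l≡j = ⊥-elim (l≢j l≡j)
  ...   | no _    = refl

-- Hence restricting `IsThreeCycle` to Alt n loses no 3-cycle of Sym n.
threeCycle⇒even : {π : Permutation′ n} → IsThreeCycle π → IsEven π
threeCycle⇒even {n} {π} π-cycle =
  (i , j) ∷ (i , k) ∷ [] , i≢j ∷ ≢-sym k≢i ∷ [] , divides-refl 1 , agree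
  where
  open IsThreeCycle π-cycle
  agree : eval ((i , j) ∷ (i , k) ∷ []) Perm.≈ π
  agree l with l Fin.≟ i
  ... | yes refl = trans (transpose-other i k (≢-sym i≢j) j≢k) (sym i↦j)
  ... | no l≢i with l Fin.≟ j
  ...   | yes refl = trans (transpose-first i k) (sym j↦k)
  ...   | no l≢j with l Fin.≟ k
  ...     | yes refl = trans (transpose-second i k) (sym k↦i)
  ...     | no l≢k   = trans (transpose-other i k l≢i l≢k) (sym (fixes l l≢i l≢j l≢k))

ThreeCycles : ∀ n → ConnectionSet (Alt n) 0ℓ
ThreeCycles n = record
  { Member    = λ (π , _) → IsThreeCycle π
  ; resp      = λ π≈ρ s → let open IsThreeCycle s in record
      { i = i ; j = j ; k = k ; i≢j = i≢j ; j≢k = j≢k ; k≢i = k≢i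
      ; i↦j   = trans (sym (π≈ρ i)) i↦j
      ; j↦k   = trans (sym (π≈ρ j)) j↦k
      ; k↦i   = trans (sym (π≈ρ k)) k↦i
      ; fixes = λ l l≢i l≢j l≢k → trans (sym (π≈ρ l)) (fixes l l≢i l≢j l≢k)
      }
  ; ε∉        = λ s → IsThreeCycle.i≢j s (IsThreeCycle.i↦j s)
  ; ⁻¹-closed = λ {(π , _)} s → let open IsThreeCycle s in record
      { i = k ; j = j ; k = i
      ; i≢j = ≢-sym j≢k ; j≢k = ≢-sym i≢j ; k≢i = ≢-sym k≢i
      ; i↦j   = back π j↦k
      ; j↦k   = back π i↦j
      ; k↦i   = back π k↦i
      ; fixes = λ l l≢k l≢j l≢i → back π (fixes l l≢i l≢j l≢k)
      }
  }
  where
  back : (π : Permutation′ n) → ∀ {a b} → π ⟨$⟩ʳ a ≡ b → π ⟨$⟩ˡ b ≡ a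
  back π eq = trans (cong (π ⟨$⟩ˡ_) (sym eq)) (Perm.inverseˡ π)

CAG : ℕ → Graph 0ℓ 0ℓ 0ℓ
CAG n = Cay (Alt n) (ThreeCycles n)

{-# OPTIONS --safe #-}
-- If T is closed under conjugation, inversion preserves adjacency: the edge
-- {γ , t γ} is sent to {γ⁻¹ , (γ⁻¹ t⁻¹ γ) γ⁻¹}.  Conjugating the right
-- multiplication by y⁻¹ with inversion gives the left multiplication by y.
-- Were R(Γ) normal, every left multiplication would be a right one, and
-- evaluating at ε would make Γ abelian, which A_n is not for n ≥ 4.
module Submission where

open import Algebra.Bundles using (Group)
import Algebra.Properties.Group as GroupProperties
open import Data.Fin.Base using (zero; suc)
open import Data.Fin.Permutation as Perm
  using (Permutation′; _⟨$⟩ʳ_; _⟨$⟩ˡ_; _∘ₚ_)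
open import Data.Fin.Permutation.Transposition.List using (eval)
open import Data.List.Base using ([]; _∷_)
open import Data.List.Relation.Unary.All using ([]; _∷_)
open import Data.Nat.Base using (ℕ; suc; _≤_; s≤s; _+_)
open import Data.Nat.Divisibility using (divides-refl)
open import Data.Product.Base using (_×_; _,_)
open import Data.Sum.Base using (inj₁; inj₂)
open import Function.Base using (_∘_)
open import Function.Bundles using (mk⇔; Injection)
open import Function.Properties.Inverse using (↔⇒↣)
open import Level using (Level)
import Relation.Binary.Reasoning.Setoid as SetoidReasoning
open import Relation.Binary.PropositionalEquality using (_≡_; refl; sym; trans; cong)
open import Relation.Nullary using (¬_; contradiction)
open import Relation.Unary using (_∈_)
open import Defs

private
  variable
    c ℓ p : Level

module _ (Γ : Group c ℓ) (T : ConnectionSet Γ p) where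
  open Group Γ hiding (sym; trans) renaming (refl to ≈-refl)
  open ConnectionSet T using (Member) renaming (⁻¹-closed to T⁻¹-closed)
  open GroupProperties Γ
  open SetoidReasoning setoid

  -- Says that T is a union of conjugacy classes of Γ.
  ConjugationClosed : Set _
  ConjugationClosed = ∀ g {t} → t ∈ Member → g ⁻¹ ∙ t ∙ g ∈ Member

  module _ (conj : ConjugationClosed) where

    private
      flipped : ∀ {y} γ t → y ≈ t ∙ γ → y ⁻¹ ≈ (γ ⁻¹ ∙ t ⁻¹ ∙ γ) ∙ γ ⁻¹
      flipped {y} γ t y≈tγ = begin
        y ⁻¹                          ≈⟨ ⁻¹-cong y≈tγ ⟩
        (t ∙ γ) ⁻¹                    ≈⟨ ⁻¹-anti-homo-∙ t γ ⟩
        γ ⁻¹ ∙ t ⁻¹                   ≈⟨ //-rightDividesʳ γ _ ⟨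
        (γ ⁻¹ ∙ t ⁻¹ ∙ γ) ∙ γ ⁻¹      ∎

    ⁻¹-adjacent : ∀ {x y} → CayleyAdjacent Γ T x y → CayleyAdjacent Γ T (x ⁻¹) (y ⁻¹)
    ⁻¹-adjacent (γ , t , t∈ , inj₁ (x≈ , y≈)) =
      γ ⁻¹ , _ , conj γ (T⁻¹-closed t∈) , inj₁ (⁻¹-cong x≈ , flipped γ t y≈)
    ⁻¹-adjacent (γ , t , t∈ , inj₂ (x≈ , y≈)) =
      γ ⁻¹ , _ , conj γ (T⁻¹-closed t∈) , inj₂ (flipped γ t x≈ , ⁻¹-cong y≈)

    ⁻¹-isAutomorphism : IsAutomorphism (Cay Γ T) _⁻¹
    ⁻¹-isAutomorphism = record
      { isBijection = record
        { isInjection = record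
          { isCongruent = record
            { cong           = ⁻¹-cong
            ; isEquivalence₁ = isEquivalence
            ; isEquivalence₂ = isEquivalence
            }
          ; injective = ⁻¹-injective
          }
        ; surjective = λ y → y ⁻¹ , λ z≈ → begin
            _ ⁻¹     ≈⟨ ⁻¹-cong z≈ ⟩
            y ⁻¹ ⁻¹  ≈⟨ ⁻¹-involutive y ⟩
            y        ∎
        }
      -- Inversion is an involution, so the converse is the forward direction applied to x⁻¹ and
      -- y⁻¹.
      ; adjacency = λ x y → mk⇔ ⁻¹-adjacent
          (Graph.~-resp (Cay Γ T) (⁻¹-involutive x) (⁻¹-involutive y) ∘ ⁻¹-adjacent)
      }

    normal⇒commutative : IsNormalCayley Γ T → ∀ x y → x ∙ y ≈ y ∙ x
    normal⇒commutative normal x y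
      with normal (record { to = _⁻¹ ; isAutomorphism = ⁻¹-isAutomorphism })
                  {rightMultiplication Γ T (y ⁻¹)} (y ⁻¹ , λ _ → ≈-refl)
    ... | δ , conj≈r = begin
      x ∙ y  ≈⟨ ∙-congˡ y≈δ ⟩
      x ∙ δ  ≈⟨ left≈right x ⟨
      y ∙ x  ∎
      where
      left≈right : ∀ z → y ∙ z ≈ z ∙ δ
      left≈right z = begin
        y ∙ z               ≈⟨ ∙-cong (⁻¹-involutive y) (⁻¹-involutive z) ⟨
        y ⁻¹ ⁻¹ ∙ z ⁻¹ ⁻¹   ≈⟨ ⁻¹-anti-homo-∙ (z ⁻¹) (y ⁻¹) ⟨
        -- The inverse automorphism is read off from the surjectivity witness `y ⁻¹`, so the
        -- conjugate sends z to this term by definition.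
        (z ⁻¹ ∙ y ⁻¹) ⁻¹    ≈⟨ conj≈r z ⟩
        z ∙ δ               ∎

      y≈δ : y ≈ δ
      y≈δ = begin
        y      ≈⟨ identityʳ y ⟨
        y ∙ ε  ≈⟨ left≈right ε ⟩
        ε ∙ δ  ≈⟨ identityˡ δ ⟩
        δ      ∎

-- Conjugation relabels points: with products read from left to right, the conjugate sends σ a to σ
-- (π a), so the cycle (i j k) becomes (σ i σ j σ k).
threeCycle-conjugate : ∀ {n} (σ : Permutation′ n) {π} →
                       IsThreeCycle π → IsThreeCycle (Perm.flip σ ∘ₚ π ∘ₚ σ)
threeCycle-conjugate σ {π} π-cycle = record
  { i = σ ⟨$⟩ʳ i ; j = σ ⟨$⟩ʳ j ; k = σ ⟨$⟩ʳ k
  ; i≢j = i≢j ∘ σ-injective ; j≢k = j≢k ∘ σ-injective ; k≢i = k≢i ∘ σ-injective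
  ; i↦j = image i↦j ; j↦k = image j↦k ; k↦i = image k↦i
  -- If l avoids the three image points, then σ⁻¹ l avoids i, j and k, so π fixes it and σ carries
  -- it back to l.
  ; fixes = λ l l≢i l≢j l≢k → trans
      (cong (σ ⟨$⟩ʳ_) (fixes (σ ⟨$⟩ˡ l) (l≢i ∘ moved) (l≢j ∘ moved) (l≢k ∘ moved)))
      (Perm.inverseʳ σ)
  }
  where
  open IsThreeCycle π-cycle
  open Injection (↔⇒↣ σ) using () renaming (injective to σ-injective)

  image : ∀ {a b} → π ⟨$⟩ʳ a ≡ b →
          (Perm.flip σ ∘ₚ π ∘ₚ σ) ⟨$⟩ʳ (σ ⟨$⟩ʳ a) ≡ σ ⟨$⟩ʳ b
  image πa≡b = cong (σ ⟨$⟩ʳ_) (trans (cong (π ⟨$⟩ʳ_) (Perm.inverseˡ σ)) πa≡b)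

  moved : ∀ {l a} → σ ⟨$⟩ˡ l ≡ a → l ≡ σ ⟨$⟩ʳ a
  moved σ⁻¹l≡a = trans (sym (Perm.inverseʳ σ)) (cong (σ ⟨$⟩ʳ_) σ⁻¹l≡a)

threeCycles-conjugationClosed : ∀ n → ConjugationClosed (Alt n) (ThreeCycles n)
threeCycles-conjugationClosed n (σ , _) = threeCycle-conjugate σ

-- With a = (0 1 2) and b = (0 1 3), the product a b sends 0 to 3 and b a sends 0 to 2.
Alt-noncommutative : ∀ m → let open Group (Alt (4 + m)) in ¬ (∀ x y → x ∙ y ≈ y ∙ x)
Alt-noncommutative m comm = contradiction (comm a b zero) λ ()
  where
  a b : Group.Carrier (Alt (4 + m))
  -- From left to right, (0 1)(0 2) is 0 ↦ 1 ↦ 2 ↦ 0; the list defining the permutation also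
  -- witnesses that it is even. The same works for `b` with 3 in place of 2.
  a = eval ts , ts , (λ ()) ∷ (λ ()) ∷ [] , divides-refl 1 , λ _ → refl
    where ts = (zero , suc zero) ∷ (zero , suc (suc zero)) ∷ []
  b = eval ts , ts , (λ ()) ∷ (λ ()) ∷ [] , divides-refl 1 , λ _ → refl
    where ts = (zero , suc zero) ∷ (zero , suc (suc (suc zero))) ∷ []

theorem2p1 : (n : ℕ) → 4 ≤ n →
    IsAutomorphism (CAG n) (Group._⁻¹ (Alt n)) × ¬ IsNormalCayley (Alt n) (ThreeCycles n)
-- Matching on the bound turns n into 4 + m, which provides the points 0, 1, 2, 3 that `a` and `b`
-- move.
theorem2p1 n@(suc (suc (suc (suc m)))) (s≤s (s≤s (s≤s (s≤s _)))) =
  ⁻¹-isAutomorphism (Alt n) (ThreeCycles n) conj ,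
  Alt-noncommutative m ∘ normal⇒commutative (Alt n) (ThreeCycles n) conj
  where conj = threeCycles-conjugationClosed n
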